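{- Let $n\geq 2$ and $k\geq 3$ be integers. Then $\vec{C}_{2n+1}\langle\emptyset\rangle$ is $k$-mixing and $\mathcal{D}_k(\vec{C}_{2n+1}\langle\emptyset\rangle)$ has diameter at most $4n+1+\lfloor \frac{n+1}{2}\rfloor$.
   Context: For $n\ge 2$, the cyclic circulant tournament $\vec{C}_{2n+1}\langle\emptyset\rangle$ has vertex set $\mathbb{Z}_{2n+1}$ and arcs $(a,a+j)$ for all $a\in\mathbb{Z}_{2n+1}$ and $j\in\{1,\dots,n\}$. For a digraph $D$ and positive integer $k$, a $k$-coloring of $D$ is a function $\alpha\colon V(D)\to\{1,\dots,k\}$ such that every color class $\{x:\alpha(x)=i\}$ (possibly empty) induces an acyclic subdigraph. The $k$-dicoloring graph $\mathcal{D}_k(D)$ has the $k$-colorings of $D$ as vertices, two being adjacent iff they differ on exactly one vertex. $D$ is $k$-mixing if $\mathcal{D}_k(D)$ is connected. -}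

module Defs where

open import Data.Nat using (ℕ; zero; suc; _+_; _*_; _≤_; _/_; _%_)
open import Data.Fin using (Fin; toℕ)
open import Data.Vec using (Vec; lookup)
open import Data.List using (List; []; _∷_)
open import Data.List.Relation.Unary.All using (All)
open import Data.List.Relation.Unary.Unique.Propositional using (Unique)
open import Data.Product using (Σ; ∃; ∃-syntax; _×_; _,_)
open import Relation.Binary.PropositionalEquality using (_≡_; _≢_)
open import Relation.Nullary using (¬_)

Digraph : ℕ → Set₁
Digraph m = Fin m → Fin m → Set

C⃗ : (n : ℕ) → Digraph (suc (2 * n))
C⃗ n a b = ∃[ j ] (1 ≤ j × j ≤ n × toℕ b ≡ (toℕ a + j) % suc (2 * n))

data ArcChain {m : ℕ} (D : Digraph m) : Fin m → List (Fin m) → Fin m → Set where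
  done : ∀ {x} → ArcChain D x [] x
  step : ∀ {x y ys z} → D x y → ArcChain D y ys z → ArcChain D x (y ∷ ys) z

record Cycle {m : ℕ} (D : Digraph m) : Set where
  constructor mkCycle
  field
    start    : Fin m
    rest     : List (Fin m)
    last     : Fin m
    distinct : Unique (start ∷ rest)
    chain    : ArcChain D start rest last
    closing  : D last start

InducesAcyclic : {m : ℕ} → Digraph m → (Fin m → Set) → Set
InducesAcyclic {m} D S = ¬ (Σ (Cycle D) λ c →
  S (Cycle.start c) × All S (Cycle.rest c))

-- Assignments V → {1..k}, represented as vectors so equality is extensional.
Assignment : ℕ → ℕ → Set
Assignment m k = Vec (Fin k) m

IsColoring : {m : ℕ} (k : ℕ) → Digraph m → Assignment m k → Set
IsColoring k D α = (i : Fin k) → InducesAcyclic D (λ x → lookup α x ≡ i)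

Coloring : {m : ℕ} (k : ℕ) → Digraph m → Set
Coloring {m} k D = Σ (Assignment m k) (IsColoring k D)

Adjacent : {m k : ℕ} {D : Digraph m} → Coloring k D → Coloring k D → Set
Adjacent {m} (α , _) (β , _) =
  Σ (Fin m) λ v → (lookup α v ≢ lookup β v) × ((u : Fin m) → u ≢ v → lookup α u ≡ lookup β u)

data Walk {m k : ℕ} {D : Digraph m} : ℕ → Coloring k D → Coloring k D → Set where
  nil  : ∀ {α} → Walk zero α α
  cons : ∀ {l α β γ} → Adjacent α β → Walk l β γ → Walk (suc l) α γ

Mixing : {m : ℕ} (k : ℕ) → Digraph m → Set
Mixing k D = (α β : Coloring k D) → ∃[ l ] Walk l α β

DiameterAtMost : {m : ℕ} (k : ℕ) → Digraph m → ℕ → Set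
DiameterAtMost k D d = (α β : Coloring k D) → ∃[ l ] (l ≤ d × Walk l α β)

{-# OPTIONS --safe #-}
module Submission where

-- The tournament is cut into two acyclic halves by any half-circle of n+1 consecutive vertices, and
-- every colour class lies in such a half-circle.  Given colourings α and β, choose colours ℓ ≠ j
-- with |α⁻¹(ℓ)| ≤ |β⁻¹(j)| and a third colour i; let I and J be half-circles containing α⁻¹(i) and
-- β⁻¹(j).  Both colourings are led to the one that is j on J, i on I ∖ J and ℓ elsewhere: from β by
-- recolouring J, I ∖ J and the rest in turn, from α by first giving i to I ∖ J and to the ℓ-coloured
-- vertices of I ∩ J, then ℓ to the complement of I ∪ J, then j to J.  Only ℓ-coloured vertices
-- change twice on the way from α, and the vertices of β⁻¹(j) never change on the way from β, so the
-- total is at most 2(2n+1) + |α⁻¹(ℓ)| − |β⁻¹(j)| ≤ 4n+2.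

open import Defs
open import Data.Bool using (Bool; true; false; if_then_else_; _∧_) renaming (_≟_ to _≟ᵇ_)
open import Data.Fin using (Fin; zero; suc; toℕ; fromℕ; fromℕ<; inject; inject₁)
open import Data.Fin.Properties
  using (_≟_; any?; all?; ¬∀⟶∃¬-smallest; suc-injective;
         toℕ-injective; toℕ<n; toℕ-fromℕ<; toℕ-inject)
open import Data.Fin.Relation.Unary.Top using (view; ‵fromℕ; ‵inject₁)
open import Data.List.Relation.Unary.All using (All; []; _∷_)
open import Data.List.Relation.Unary.AllPairs using ([]; _∷_)
open import Data.Nat using (ℕ; zero; suc; _+_; _*_; _∸_; _≤_; _<_; _/_; _%_; z≤n; s≤s; s≤s⁻¹; _≤?_)
open import Data.Nat.DivMod
  using (/-monoˡ-≤; %-distribˡ-+; m%n%n≡m%n; m%n<n; m<n⇒m%n≡m; n%n≡0; [m+n]%n≡m%n;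
         m≤n⇒[n∸m]%m≡n%m; _mod_)
open import Data.Nat.Properties hiding (_≟_; suc-injective)
open import Data.Nat.Tactic.RingSolver using (solve-∀)
open import Data.Product using (Σ; ∃-syntax; _×_; _,_; proj₁; proj₂; map₂)
open import Data.Sum using (_⊎_; inj₁; inj₂)
open import Data.Vec using ([]; _∷_; lookup; tabulate; _[_]≔_)
open import Data.Vec.Properties
  using (lookup∘tabulate; tabulate∘lookup; lookup∘updateAt; lookup∘updateAt′)
open import Function using (_∘_)
open import Relation.Binary.PropositionalEquality
  using (_≡_; _≢_; refl; sym; trans; cong; subst; subst₂; ≢-sym; module ≡-Reasoning)
open import Relation.Nullary using (¬_; Dec; yes; no; does; contradiction)
open import Relation.Nullary.Decidable using (dec-true; dec-false; ¬?; _×-dec_)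
open import Relation.Unary using (Decidable)

open import Algebra.Properties.CommutativeMonoid.Sum +-0-commutativeMonoid
  using (sum; ∑-distrib-+; ∑-comm)
open import Algebra.Properties.CommutativeSemigroup +-commutativeSemigroup
  using (x∙yz≈y∙xz; xy∙z≈xz∙y)

-- Finite sums and indicators.

does-true⇒ : ∀ {P : Set} (P? : Dec P) → does P? ≡ true → P
does-true⇒ (yes p) _ = p

does-false⇒ : ∀ {P : Set} (P? : Dec P) → does P? ≡ false → ¬ P
does-false⇒ (no ¬p) _ = ¬p

𝟙 : ∀ {P : Set} → Dec P → ℕ
𝟙 P? = if does P? then 1 else 0

sum-mono-≤ : ∀ {m} {f g : Fin m → ℕ} → (∀ x → f x ≤ g x) → sum f ≤ sum g
sum-mono-≤ {zero}  f≤g = z≤n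
sum-mono-≤ {suc m} f≤g = +-mono-≤ (f≤g zero) (sum-mono-≤ (f≤g ∘ suc))

sum-const : ∀ m c → sum {m} (λ _ → c) ≡ m * c
sum-const zero    c = refl
sum-const (suc m) c = cong (c +_) (sum-const m c)

f[i]≤sum : ∀ {m} (f : Fin m → ℕ) i → f i ≤ sum f
f[i]≤sum f zero    = m≤m+n _ _
f[i]≤sum f (suc i) = ≤-trans (f[i]≤sum (f ∘ suc) i) (m≤n+m _ _)

sum-𝟙 : ∀ {k} (c : Fin k) → sum (λ d → 𝟙 (c ≟ d)) ≡ 1
sum-𝟙 {suc k} zero    = cong suc (trans (sum-const k 0) (*-zeroʳ k))
sum-𝟙         (suc c) = sum-𝟙 c

-- Choosing the colours.

count : ∀ {m k} → (Fin m → Fin k) → Fin k → ℕ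
count f c = sum (λ x → 𝟙 (f x ≟ c))

-- The cyclic shift c ↦ c - 1. Being surjective and, for at least two colours, free of fixed points,
-- it pairs each colour ℓ with a different candidate for j.
rotate : ∀ {k} → Fin (suc k) → Fin (suc k)
rotate zero    = fromℕ _
rotate (suc c) = inject₁ c

rotate-surjective : ∀ {k} (c : Fin (suc k)) → ∃[ d ] rotate d ≡ c
rotate-surjective c with view c
... | ‵fromℕ     = zero , refl
... | ‵inject₁ d = suc d , refl

rotate≢ : ∀ {k} (c : Fin (suc (suc k))) → rotate c ≢ c
rotate≢ zero          ()
rotate≢ (suc zero)    ()
rotate≢ (suc (suc c)) eq = rotate≢-inject₁ (suc c) eq
  where
  rotate≢-inject₁ : ∀ {k} (c : Fin k) → inject₁ c ≢ suc c
  rotate≢-inject₁ (suc c) eq = rotate≢-inject₁ c (suc-injective eq)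

-- Summed over all colours, each side counts every vertex once, so the
-- inequality cannot fail for every colour.
∃-count≤ : ∀ {m k} (f g : Fin m → Fin (suc k)) → ∃[ c ] count f c ≤ count g (rotate c)
∃-count≤ {m} {k} f g with any? (λ c → count f c ≤? count g (rotate c))
... | yes found = found
... | no  ¬found = contradiction all-fewer (<⇒≱ too-many)
  where
  open ≤-Reasoning
  all-fewer : sum (λ c → suc (count g (rotate c))) ≤ sum (count f)
  all-fewer = sum-mono-≤ (λ c → ≰⇒> (λ le → ¬found (c , le)))

  hit : ∀ d → 1 ≤ sum (λ c → 𝟙 (d ≟ rotate c))
  hit d with rotate-surjective d
  ... | c , refl = ≤-trans
    (≤-reflexive (sym (cong (if_then 1 else 0) (dec-true (rotate c ≟ rotate c) refl))))
    (f[i]≤sum (λ c′ → 𝟙 (rotate c ≟ rotate c′)) c)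

  too-many : sum (count f) < sum (λ c → suc (count g (rotate c)))
  too-many = begin-strict
    sum (count f)                                  ≡⟨ ∑-comm (λ c x → 𝟙 (f x ≟ c)) ⟩
    sum (λ x → sum (λ c → 𝟙 (f x ≟ c)))            ≤⟨ sum-mono-≤ (λ x → ≤-trans (≤-reflexive (sum-𝟙 (f x))) (hit (g x))) ⟩
    sum (λ x → sum (λ c → 𝟙 (g x ≟ rotate c)))     ≡⟨ ∑-comm (λ c x → 𝟙 (g x ≟ rotate c)) ⟨
    sum (λ c → count g (rotate c))                 <⟨ s≤s (m≤n+m _ k) ⟩
    suc k + sum (λ c → count g (rotate c))         ≡⟨ cong (_+ sum (λ c → count g (rotate c))) (trans (sum-const (suc k) 1) (*-identityʳ (suc k))) ⟨
    sum {suc k} (λ _ → 1) + sum (λ c → count g (rotate c)) ≡⟨ ∑-distrib-+ {suc k} (λ _ → 1) (count g ∘ rotate) ⟨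
    sum (λ c → suc (count g (rotate c)))           ∎

third-colour : ∀ {k} (c d : Fin (3 + k)) → ∃[ e ] (e ≢ c × e ≢ d)
third-colour = λ where
  zero          zero          → suc zero       , (λ ()) , (λ ())
  zero          (suc zero)    → suc (suc zero) , (λ ()) , (λ ())
  zero          (suc (suc _)) → suc zero       , (λ ()) , (λ ())
  (suc zero)    zero          → suc (suc zero) , (λ ()) , (λ ())
  (suc (suc _)) zero          → suc zero       , (λ ()) , (λ ())
  (suc _)       (suc _)       → zero           , (λ ()) , (λ ())

-- Recolouring paths on bare assignments.

DifferOnce : ∀ {m k} → Assignment m k → Assignment m k → Set
DifferOnce a b = ∃[ v ] (lookup a v ≢ lookup b v × (∀ u → u ≢ v → lookup a u ≡ lookup b u))

DifferOnce-sym : ∀ {m k} {a b : Assignment m k} → DifferOnce a b → DifferOnce b a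
DifferOnce-sym (v , ≢v , ≡u) = v , ≢-sym ≢v , λ u u≢v → sym (≡u u u≢v)

-- Unlike `Walk`, the vertices carry no acyclicity proof in their identity, so paths can be
-- concatenated and reversed by their assignments alone. `P` is recorded for every assignment after
-- the first.
data Path {m k} (P : Assignment m k → Set) : ℕ → Assignment m k → Assignment m k → Set where
  nil  : ∀ {a} → Path P 0 a a
  cons : ∀ {l a b c} → DifferOnce a b → P b → Path P l b c → Path P (suc l) a c

module _ {m k} {P : Assignment m k → Set} where

  _++ᵖ_ : ∀ {l₁ l₂ a b c} → Path P l₁ a b → Path P l₂ b c → Path P (l₁ + l₂) a c
  nil        ++ᵖ q = q
  cons d v p ++ᵖ q = cons d v (p ++ᵖ q)

  reverse : ∀ {l a b} → P a → Path P l a b → Path P l b a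
  reverse Pa nil = nil
  reverse Pa (cons {l} {a} {b} {c} d Pb p) = subst (λ l → Path P l c a) (+-comm l 1)
    (reverse Pb p ++ᵖ cons (DifferOnce-sym {a = a} {b} d) Pa nil)

  end-valid : ∀ {l a b} → P a → Path P l a b → P b
  end-valid Pa nil = Pa
  end-valid Pa (cons _ Pb p) = end-valid Pb p

mapᵖ : ∀ {m k l} {P : Assignment (suc m) k → Set} {c a b} →
       Path (λ a → P (c ∷ a)) l a b → Path P l (c ∷ a) (c ∷ b)
mapᵖ nil = nil
mapᵖ (cons (v , ≢v , ≡u) Pb p) =
  cons (suc v , ≢v , λ { zero _ → refl ; (suc u) u≢v → ≡u u (u≢v ∘ cong suc) }) Pb (mapᵖ p)

hamming : ∀ {m k} → Assignment m k → Assignment m k → ℕ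
hamming a b = sum (λ x → 𝟙 (¬? (lookup a x ≟ lookup b x)))

Mixture : ∀ {m k} (a b c : Assignment m k) → Set
Mixture a b c = ∀ x → lookup c x ≡ lookup a x ⊎ lookup c x ≡ lookup b x

-- The vertices where `a` and `b` disagree are switched one at a time, the tail before the head, so
-- each intermediate assignment is a mixture.
gradual : ∀ {m k} {P : Assignment m k → Set} (a b : Assignment m k) →
          (∀ c → Mixture a b c → P c) → Path P (hamming a b) a b
gradual [] [] _ = nil
gradual {P = P} (x ∷ a) (y ∷ b) valid = result
  where
  tail-path : Path P (hamming a b) (x ∷ a) (x ∷ b)
  tail-path = mapᵖ (gradual a b λ c mix →
    valid (x ∷ c) λ { zero → inj₁ refl ; (suc u) → mix u })

  result : Path P (hamming (x ∷ a) (y ∷ b)) (x ∷ a) (y ∷ b)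
  result with x ≟ y
  ... | yes refl = tail-path
  ... | no x≢y   = subst (λ l → Path P l (x ∷ a) (y ∷ b)) (+-comm (hamming a b) 1)
    (tail-path ++ᵖ cons
      (zero , x≢y , λ { zero 0≢0 → contradiction refl 0≢0 ; (suc u) _ → refl })
      (valid (y ∷ b) λ { zero → inj₂ refl ; (suc u) → inj₂ refl })
      nil)

toWalk : ∀ {m k l} {D : Digraph m} {a b} (va : IsColoring k D a) (vb : IsColoring k D b) →
         Path (IsColoring k D) (suc l) a b → Walk {D = D} (suc l) (a , va) (b , vb)
toWalk va vb (cons d _ nil)             = cons d nil
toWalk va vb (cons d v p@(cons _ _ _))  = cons d (toWalk v vb p)

-- Bisections and growing one colour class.

acyclic-⊆ : ∀ {m} {D : Digraph m} {S T : Fin m → Set} →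
            (∀ x → S x → T x) → InducesAcyclic D T → InducesAcyclic D S
acyclic-⊆ {S = S} {T} S⊆T acyclic (c , s , r) = acyclic (c , S⊆T _ s , all r)
  where
  all : ∀ {xs} → All S xs → All T xs
  all []       = []
  all (p ∷ ps) = S⊆T _ p ∷ all ps

-- `outside` makes the `false` half nonempty; it supplies a vertex to recolour when the `true` half
-- is monochromatic.
record Bisection {m} (D : Digraph m) : Set where
  field
    side    : Fin m → Bool
    acyclic : ∀ b → InducesAcyclic D (λ x → side x ≡ b)
    outside : ∃[ x ] side x ≡ false

module Recolouring {m k : ℕ} (D : Digraph m) where

  Valid : (Fin m → Fin k) → Set
  Valid f = IsColoring k D (tabulate f)

  class-acyclic : ∀ {f} → Valid f → ∀ c → InducesAcyclic D (λ x → f x ≡ c)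
  class-acyclic {f} valid c = acyclic-⊆ (λ x → trans (lookup∘tabulate f x)) (valid c)

  -- `e` is a budget of recolourings per vertex. Keeping it as a function lets the total length be
  -- estimated vertex by vertex.
  _⟶[_]_ : (Fin m → Fin k) → (Fin m → ℕ) → (Fin m → Fin k) → Set
  f ⟶[ e ] g = ∃[ l ] (l ≤ sum e × Path (IsColoring k D) l (tabulate f) (tabulate g))

  infixr 5 _▷_
  _▷_ : ∀ {f g h e e′} → f ⟶[ e ] g → g ⟶[ e′ ] h → f ⟶[ (λ x → e x + e′ x) ] h
  _▷_ {e = e} {e′} (l , l≤ , p) (l′ , l′≤ , p′) =
    l + l′ , ≤-trans (+-mono-≤ l≤ l′≤) (≤-reflexive (sym (∑-distrib-+ e e′))) , p ++ᵖ p′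

  -- Only the class of `c` gains vertices, and it stays inside the acyclic set `H`; every other
  -- class only shrinks. Hence the changes may be made in any order.
  fill : ∀ {f g : Fin m → Fin k} {e c} {H : Fin m → Set} → InducesAcyclic D H → Valid f →
         (∀ x → f x ≡ c → H x) →
         (∀ x → g x ≡ f x ⊎ (g x ≡ c × H x × 1 ≤ e x)) →
         f ⟶[ e ] g × Valid g
  fill {f} {g} {e} {c} {H} acyclic valid c⊆H change =
    (_ , sum-mono-≤ cost , path) , end-valid valid path
    where
    mixture-valid : ∀ a → Mixture (tabulate f) (tabulate g) a → IsColoring k D a
    mixture-valid a mix i with i ≟ c
    ... | yes refl = acyclic-⊆ inH acyclic
      where
      inH : ∀ x → lookup a x ≡ i → H x
      inH x ax≡i with mix x | change x
      ... | inj₁ ax≡f | _ = c⊆H x (trans (sym (lookup∘tabulate f x)) (trans (sym ax≡f) ax≡i))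
      ... | inj₂ ax≡g | inj₁ g≡f =
        c⊆H x (trans (sym g≡f) (trans (sym (lookup∘tabulate g x)) (trans (sym ax≡g) ax≡i)))
      ... | inj₂ ax≡g | inj₂ (_ , h , _) = h
    ... | no i≢c = acyclic-⊆ old (class-acyclic valid i)
      where
      old : ∀ x → lookup a x ≡ i → f x ≡ i
      old x ax≡i with mix x | change x
      ... | inj₁ ax≡f | _ = trans (sym (lookup∘tabulate f x)) (trans (sym ax≡f) ax≡i)
      ... | inj₂ ax≡g | inj₁ g≡f =
        trans (sym g≡f) (trans (sym (lookup∘tabulate g x)) (trans (sym ax≡g) ax≡i))
      ... | inj₂ ax≡g | inj₂ (g≡c , _) = contradiction
        (trans (sym ax≡i) (trans ax≡g (trans (lookup∘tabulate g x) g≡c))) i≢c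

    path = gradual (tabulate f) (tabulate g) mixture-valid

    cost : ∀ x → 𝟙 (¬? (lookup (tabulate f) x ≟ lookup (tabulate g) x)) ≤ e x
    cost x with lookup (tabulate f) x ≟ lookup (tabulate g) x | change x
    ... | yes _ | _ = z≤n
    ... | no ≢  | inj₁ g≡f = contradiction
      (trans (lookup∘tabulate f x) (trans (sym g≡f) (sym (lookup∘tabulate g x)))) ≢
    ... | no _  | inj₂ (_ , _ , 1≤e) = 1≤e


-- Two routes to a common colouring.

module Connect {m k : ℕ} {D : Digraph m} {a b : Fin m → Fin k}
  (va : Recolouring.Valid D a) (vb : Recolouring.Valid D b)
  {i j ℓ : Fin k} (i≢j : i ≢ j) (i≢ℓ : i ≢ ℓ) (j≢ℓ : j ≢ ℓ) (A B : Bisection D)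
  (Aᵢ⊆I : ∀ x → a x ≡ i → Bisection.side A x ≡ true)
  (Bⱼ⊆J : ∀ x → b x ≡ j → Bisection.side B x ≡ true)
  (Aℓ≤Bj : count a ℓ ≤ count b j)
  where

  open Recolouring {m} {k} D
  open Bisection

  I J : Fin m → Bool
  I = side A
  J = side B

  a₁ a₂ b₁ b₂ goal : Fin m → Fin k
  a₁ x = if J x then (if I x ∧ does (a x ≟ ℓ) then i else a x) else (if I x then i else a x)
  a₂ x = if J x then (if I x ∧ does (a x ≟ ℓ) then i else a x) else (if I x then i else ℓ)
  goal x = if J x then j else (if I x then i else ℓ)
  b₁ x = if J x then j else b x
  b₂ x = if J x then j else (if I x then i else b x)

  e₁ e₂ e₃ d₁ d₂ d₃ : Fin m → ℕ
  e₁ x = if J x then (if I x then 𝟙 (a x ≟ ℓ) else 0) else (if I x then 1 else 0)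
  e₂ x = if J x then 0 else (if I x then 0 else 1)
  e₃ x = if J x then 1 else 0
  d₁ x = if J x then 𝟙 (¬? (b x ≟ j)) else 0
  d₂ x = if J x then 0 else (if I x then 1 else 0)
  d₃ x = if J x then 0 else (if I x then 0 else 1)

  α⟶a₁ : a ⟶[ e₁ ] a₁ × Valid a₁
  α⟶a₁ = fill (acyclic A true) va (Aᵢ⊆I) change
    where
    change : ∀ x → a₁ x ≡ a x ⊎ (a₁ x ≡ i × I x ≡ true × 1 ≤ e₁ x)
    change x with J x | I x | a x ≟ ℓ
    ... | true  | true  | yes _ = inj₂ (refl , refl , ≤-refl)
    ... | true  | true  | no _  = inj₁ refl
    ... | true  | false | _     = inj₁ refl
    ... | false | true  | _     = inj₂ (refl , refl , ≤-refl)
    ... | false | false | _     = inj₁ refl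

  -- The first stage removed ℓ from all of `I`, so the class of ℓ can grow within the acyclic
  -- complement of `I`.
  a₁⟶a₂ : a₁ ⟶[ e₂ ] a₂ × Valid a₂
  a₁⟶a₂ = fill (acyclic A false) (proj₂ α⟶a₁) class change
    where
    class : ∀ x → a₁ x ≡ ℓ → I x ≡ false
    class x with J x | I x | a x ≟ ℓ
    ... | true  | true  | yes _  = λ i≡ℓ → contradiction i≡ℓ i≢ℓ
    ... | true  | true  | no a≢ℓ = λ a≡ℓ → contradiction a≡ℓ a≢ℓ
    ... | false | true  | _      = λ i≡ℓ → contradiction i≡ℓ i≢ℓ
    ... | _     | false | _      = λ _ → refl

    change : ∀ x → a₂ x ≡ a₁ x ⊎ (a₂ x ≡ ℓ × I x ≡ false × 1 ≤ e₂ x)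
    change x with J x | I x
    ... | true  | _     = inj₁ refl
    ... | false | true  = inj₁ refl
    ... | false | false = inj₂ (refl , refl , ≤-refl)

  -- By now only i and ℓ occur outside `J`, so j is confined to `J`.
  a₂⟶goal : a₂ ⟶[ e₃ ] goal × Valid goal
  a₂⟶goal = fill (acyclic B true) (proj₂ a₁⟶a₂) class change
    where
    class : ∀ x → a₂ x ≡ j → J x ≡ true
    class x with J x | I x
    ... | true  | _     = λ _ → refl
    ... | false | true  = λ i≡j → contradiction i≡j i≢j
    ... | false | false = λ ℓ≡j → contradiction (sym ℓ≡j) j≢ℓ

    change : ∀ x → goal x ≡ a₂ x ⊎ (goal x ≡ j × J x ≡ true × 1 ≤ e₃ x)
    change x with J x
    ... | true  = inj₂ (refl , refl , ≤-refl)
    ... | false = inj₁ refl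

  β⟶b₁ : b ⟶[ d₁ ] b₁ × Valid b₁
  β⟶b₁ = fill (acyclic B true) vb (Bⱼ⊆J) change
    where
    change : ∀ x → b₁ x ≡ b x ⊎ (b₁ x ≡ j × J x ≡ true × 1 ≤ d₁ x)
    change x with J x | b x ≟ j
    ... | true  | yes b≡j = inj₁ (sym b≡j)
    ... | true  | no _    = inj₂ (refl , refl , ≤-refl)
    ... | false | _       = inj₁ refl

  -- With `J` entirely coloured j, the classes of i and ℓ lie in the acyclic complement of `J`,
  -- which makes this stage and the next one safe.
  b₁⟶b₂ : b₁ ⟶[ d₂ ] b₂ × Valid b₂
  b₁⟶b₂ = fill (acyclic B false) (proj₂ β⟶b₁) class change
    where
    class : ∀ x → b₁ x ≡ i → J x ≡ false
    class x with J x
    ... | true  = λ j≡i → contradiction (sym j≡i) i≢j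
    ... | false = λ _ → refl

    change : ∀ x → b₂ x ≡ b₁ x ⊎ (b₂ x ≡ i × J x ≡ false × 1 ≤ d₂ x)
    change x with J x | I x
    ... | true  | _     = inj₁ refl
    ... | false | true  = inj₂ (refl , refl , ≤-refl)
    ... | false | false = inj₁ refl

  b₂⟶goal : b₂ ⟶[ d₃ ] goal × Valid goal
  b₂⟶goal = fill (acyclic B false) (proj₂ b₁⟶b₂) class change
    where
    class : ∀ x → b₂ x ≡ ℓ → J x ≡ false
    class x with J x
    ... | true  = λ j≡ℓ → contradiction j≡ℓ j≢ℓ
    ... | false = λ _ → refl

    change : ∀ x → goal x ≡ b₂ x ⊎ (goal x ≡ ℓ × J x ≡ false × 1 ≤ d₃ x)
    change x with J x | I x
    ... | true  | _     = inj₁ refl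
    ... | false | true  = inj₁ refl
    ... | false | false = inj₂ (refl , refl , ≤-refl)

  e d : Fin m → ℕ
  e x = e₁ x + (e₂ x + e₃ x)
  d x = d₁ x + (d₂ x + d₃ x)

  there : a ⟶[ e ] goal
  there = proj₁ α⟶a₁ ▷ proj₁ a₁⟶a₂ ▷ proj₁ a₂⟶goal

  back : b ⟶[ d ] goal
  back = proj₁ β⟶b₁ ▷ proj₁ b₁⟶b₂ ▷ proj₁ b₂⟶goal

  -- Outside `J` each route changes `x` at most once, and `b x` is not j. Inside `J` the route from
  -- `b` spends 1 exactly when `b x` is not j, while the route from `a` spends 1, plus 1 more only
  -- if `a x` is ℓ.
  pointwise : ∀ x → (e x + d x) + 𝟙 (b x ≟ j) ≤ 2 + 𝟙 (a x ≟ ℓ)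
  pointwise x with J x in Jx | I x | a x ≟ ℓ | b x ≟ j
  ... | true  | true  | yes _ | yes _ = ≤-refl
  ... | true  | true  | yes _ | no _  = ≤-refl
  ... | true  | true  | no _  | yes _ = ≤-refl
  ... | true  | true  | no _  | no _  = ≤-refl
  ... | true  | false | _     | yes _ = m≤m+n 2 _
  ... | true  | false | _     | no _  = m≤m+n 2 _
  ... | false | _     | _     | yes b≡j = contradiction (trans (sym Jx) (Bⱼ⊆J x b≡j)) λ ()
  ... | false | true  | _     | no _  = m≤m+n 2 _
  ... | false | false | _     | no _  = m≤m+n 2 _

  -- Summing `pointwise` leaves the excess `count a ℓ` and the saving `count b j`; the choice of
  -- colours makes the saving at least the excess. Adding `count a ℓ` to both sides avoids truncated
  -- subtraction.
  bound : proj₁ there + proj₁ back ≤ m * 2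
  bound = +-cancelʳ-≤ (count a ℓ) _ _ (begin
    (proj₁ there + proj₁ back) + count a ℓ
      ≤⟨ +-mono-≤ (+-mono-≤ (proj₁ (proj₂ there)) (proj₁ (proj₂ back))) Aℓ≤Bj ⟩
    (sum e + sum d) + count b j
      ≡⟨ cong (_+ count b j) (∑-distrib-+ e d) ⟨
    sum (λ x → e x + d x) + count b j
      ≡⟨ ∑-distrib-+ (λ x → e x + d x) (λ x → 𝟙 (b x ≟ j)) ⟨
    sum (λ x → (e x + d x) + 𝟙 (b x ≟ j))
      ≤⟨ sum-mono-≤ pointwise ⟩
    sum (λ x → 2 + 𝟙 (a x ≟ ℓ))
      ≡⟨ ∑-distrib-+ {m} (λ _ → 2) (λ x → 𝟙 (a x ≟ ℓ)) ⟩
    sum {m} (λ _ → 2) + count a ℓ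
      ≡⟨ cong (_+ count a ℓ) (sum-const (m) 2) ⟩
    m * 2 + count a ℓ ∎)
    where open ≤-Reasoning


  a⟶b : ∃[ l ] (l ≤ m * 2 × Path (IsColoring k D) l (tabulate a) (tabulate b))
  a⟶b = _ , bound , proj₂ (proj₂ there) ++ᵖ reverse vb (proj₂ (proj₂ back))

-- From paths to walks between colourings.

module Bisectable {m k : ℕ} (D : Digraph m)
  (bisect : ∀ α → IsColoring (3 + k) D α → ∀ c →
            Σ (Bisection D) λ B → ∀ x → lookup α x ≡ c → Bisection.side B x ≡ true)
  where

  open Bisection

  valid-tabulate : ∀ α → IsColoring (3 + k) D α → IsColoring (3 + k) D (tabulate (lookup α))
  valid-tabulate α = subst (IsColoring (3 + k) D) (sym (tabulate∘lookup α))

  connect : ∀ α β → IsColoring (3 + k) D α → IsColoring (3 + k) D β →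
            ∃[ l ] (l ≤ m * 2 × Path (IsColoring (3 + k) D) l α β)
  connect α β vα vβ =
    let ℓ , Aℓ≤Bj     = ∃-count≤ (lookup α) (lookup β)
        i , i≢ℓ , i≢j = third-colour ℓ (rotate ℓ)
        A , Aᵢ⊆I      = bisect α vα i
        B , Bⱼ⊆J      = bisect β vβ (rotate ℓ)
        l , l≤ , p    = Connect.a⟶b (valid-tabulate α vα) (valid-tabulate β vβ)
                          i≢j i≢ℓ (rotate≢ ℓ) A B Aᵢ⊆I Bⱼ⊆J Aℓ≤Bj
    in l , l≤ , subst₂ (Path (IsColoring (3 + k) D) l) (tabulate∘lookup α) (tabulate∘lookup β) p

  -- The argument of `fill` for a single vertex: the class of `c` grows inside `H`, the others do
  -- not grow.
  recolour-vertex : ∀ α → IsColoring (3 + k) D α → ∀ {H : Fin (m) → Set} {c v} →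
                    InducesAcyclic D H → (∀ x → lookup α x ≡ c → H x) → H v → c ≢ lookup α v →
                    ∃[ α′ ] (IsColoring (3 + k) D α′ × DifferOnce α α′)
  recolour-vertex α vα {H} {c} {v} acyclic c⊆H Hv c≢αv =
    α [ v ]≔ c , valid ,
    (v , (λ αv≡ → c≢αv (sym (trans αv≡ at-v))) , λ u u≢v → sym (lookup∘updateAt′ u v u≢v α))
    where
    at-v : lookup (α [ v ]≔ c) v ≡ c
    at-v = lookup∘updateAt v α

    valid : IsColoring (3 + k) D (α [ v ]≔ c)
    valid i with i ≟ c
    ... | yes refl = acyclic-⊆ inH acyclic
      where
      inH : ∀ x → lookup (α [ v ]≔ c) x ≡ c → H x
      inH x ≡c with x ≟ v
      ... | yes refl = Hv
      ... | no x≢v   = c⊆H x (trans (sym (lookup∘updateAt′ x v x≢v α)) ≡c)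
    ... | no i≢c = acyclic-⊆ old (vα i)
      where
      old : ∀ x → lookup (α [ v ]≔ c) x ≡ i → lookup α x ≡ i
      old x ≡i with x ≟ v
      ... | yes refl = contradiction (trans (sym ≡i) at-v) i≢c
      ... | no x≢v   = trans (sym (lookup∘updateAt′ x v x≢v α)) ≡i

  -- If the half containing colour `zero` has a vertex of another colour, that vertex can become
  -- `zero`. Otherwise this half is all `zero`, every other class lies in the opposite half, and a
  -- vertex there can take a third colour.
  neighbour : ∀ α → IsColoring (3 + k) D α →
              ∃[ α′ ] (IsColoring (3 + k) D α′ × DifferOnce α α′)
  neighbour α vα with bisect α vα zero
  ... | B , zero⊆ with any? (λ x → (side B x ≟ᵇ true) ×-dec ¬? (zero ≟ lookup α x))
  ... | yes (v , Bv , 0≢αv) = recolour-vertex α vα (acyclic B true) zero⊆ Bv 0≢αv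
  ... | no all-zero with outside B
  ... | v , Bv with third-colour zero (lookup α v)
  ... | c , c≢0 , c≢αv = recolour-vertex α vα (acyclic B false) c⊆ Bv c≢αv
    where
    c⊆ : ∀ x → lookup α x ≡ c → side B x ≡ false
    c⊆ x αx≡c with side B x in Bx
    ... | false = refl
    ... | true  = contradiction (x , Bx , λ 0≡αx → c≢0 (sym (trans 0≡αx αx≡c))) all-zero

  diameter : DiameterAtMost (3 + k) D (m * 2)
  diameter (α , vα) (β , vβ) =
    let l , l≤ , p = connect α β vα vβ in walk p vα vβ l≤
    where
    walk : ∀ {l α β} → Path (IsColoring (3 + k) D) l α β →
           (vα : IsColoring (3 + k) D α) (vβ : IsColoring (3 + k) D β) → l ≤ m * 2 →
           ∃[ l ] (l ≤ m * 2 × Walk {D = D} l (α , vα) (β , vβ))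
    walk p@(cons _ _ _) vα vβ l≤ = _ , l≤ , toWalk vα vβ p
    -- A trivial path does not identify the two acyclicity proofs, so it is replaced by a detour.
    walk {α = α} nil vα vβ _ =
      let α′ , vα′ , d = neighbour α vα
      in 2 , *-monoˡ-≤ 2 (≤-trans (s≤s z≤n) (toℕ<n (proj₁ d))) ,
         cons {β = α′ , vα′} d (cons (DifferOnce-sym {a = α} {α′} d) nil)

-- Acyclicity from a potential.

acyclic-if-increasing : ∀ {m} {D : Digraph m} {S : Fin m → Set} (p : Fin m → ℕ) →
                        (∀ x y → S x → S y → D x y → p x < p y) → InducesAcyclic D S
acyclic-if-increasing {D = D} {S} p p< (mkCycle s r l _ chain l→s , Ss , Sr) =
  -- The potential never drops along the chain, yet the closing arc would have to raise it strictly
  -- back to the start. The inequality from `along` is weak because the chain is empty for a loop.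
  let Sl , s≤l = along chain Ss Sr in <⇒≱ (p< _ _ Sl Ss l→s) s≤l
  where
  along : ∀ {x ys z} → ArcChain D x ys z → S x → All S ys → S z × p x ≤ p z
  along done Sx [] = Sx , ≤-refl
  along (step x→y c) Sx (Sy ∷ Sys) =
    let Sz , y≤z = along c Sy Sys in Sz , ≤-trans (<⇒≤ (p< _ _ Sx Sy x→y)) y≤z

-- Clockwise distance on the circle.

module CyclicTournament (n : ℕ) (1≤n : 1 ≤ n) where

  N : ℕ
  N = suc (2 * n)

  open ≡-Reasoning

  N≡ : N ≡ suc n + n
  N≡ = cong (λ k → suc (n + k)) (+-identityʳ n)

  n<N : n < N
  n<N = s≤s (m≤m+n n _)

  %-+ˡ : ∀ u v → (u % N + v) % N ≡ (u + v) % N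
  %-+ˡ u v = begin
    (u % N + v) % N             ≡⟨ %-distribˡ-+ (u % N) v N ⟩
    (u % N % N + v % N) % N     ≡⟨ cong (λ w → (w + v % N) % N) (m%n%n≡m%n u N) ⟩
    (u % N + v % N) % N         ≡⟨ %-distribˡ-+ u v N ⟨
    (u + v) % N                 ∎

  shift : Fin N → ℕ → Fin N
  shift x j = (toℕ x + j) mod N

  toℕ-shift : ∀ x j → toℕ (shift x j) ≡ (toℕ x + j) % N
  toℕ-shift x j = toℕ-fromℕ< (m%n<n (toℕ x + j) N)

  -- The residue of `x` - `s`: the number of clockwise steps from `s` to `x`, with `N ∸ toℕ s`
  -- standing for -`s`.
  dist : Fin N → Fin N → ℕ
  dist s x = (toℕ x + (N ∸ toℕ s)) % N

  dist<N : ∀ s x → dist s x < N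
  dist<N s x = m%n<n (toℕ x + (N ∸ toℕ s)) N

  dist≤2n : ∀ s x → dist s x ≤ 2 * n
  dist≤2n s x = s≤s⁻¹ (dist<N s x)

  dist-self : ∀ s → dist s s ≡ 0
  dist-self s = trans (cong (_% N) (m+[n∸m]≡n (<⇒≤ (toℕ<n s)))) (n%n≡0 N)

  dist-step : ∀ s x y j → toℕ y ≡ (toℕ x + j) % N → dist s y ≡ (dist s x + j) % N
  dist-step s x y j eq = begin
    (toℕ y + r) % N              ≡⟨ cong (λ w → (w + r) % N) eq ⟩
    ((toℕ x + j) % N + r) % N    ≡⟨ %-+ˡ (toℕ x + j) r ⟩
    ((toℕ x + j) + r) % N        ≡⟨ cong (_% N) (xy∙z≈xz∙y (toℕ x) j r) ⟩
    ((toℕ x + r) + j) % N        ≡⟨ %-+ˡ (toℕ x + r) j ⟨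
    (dist s x + j) % N           ∎
    where r = N ∸ toℕ s

  toℕ≡dist : ∀ s x → toℕ x ≡ (dist s x + toℕ s) % N
  toℕ≡dist s x = sym (begin
    (dist s x + toℕ s) % N                    ≡⟨ %-+ˡ (toℕ x + (N ∸ toℕ s)) (toℕ s) ⟩
    (toℕ x + (N ∸ toℕ s) + toℕ s) % N         ≡⟨ cong (_% N) (+-assoc (toℕ x) (N ∸ toℕ s) (toℕ s)) ⟩
    (toℕ x + (N ∸ toℕ s + toℕ s)) % N         ≡⟨ cong (λ w → (toℕ x + w) % N) (m∸n+n≡m (<⇒≤ (toℕ<n s))) ⟩
    (toℕ x + N) % N                           ≡⟨ [m+n]%n≡m%n (toℕ x) N ⟩
    toℕ x % N                                 ≡⟨ m<n⇒m%n≡m (toℕ<n x) ⟩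
    toℕ x                                     ∎)

  -- Turns a computation with distances from a common origin `s` back into the equation that defines
  -- an arc.
  dist-step⁻¹ : ∀ s x y j → (dist s x + j) % N ≡ dist s y → toℕ y ≡ (toℕ x + j) % N
  dist-step⁻¹ s x y j eq = begin
    toℕ y                                     ≡⟨ toℕ≡dist s y ⟩
    (dist s y + toℕ s) % N                    ≡⟨ cong (λ w → (w + toℕ s) % N) eq ⟨
    ((dist s x + j) % N + toℕ s) % N          ≡⟨ %-+ˡ (dist s x + j) (toℕ s) ⟩
    (dist s x + j + toℕ s) % N                ≡⟨ cong (_% N) (xy∙z≈xz∙y (dist s x) j (toℕ s)) ⟩
    (dist s x + toℕ s + j) % N                ≡⟨ %-+ˡ (dist s x + toℕ s) j ⟨
    ((dist s x + toℕ s) % N + j) % N          ≡⟨ cong (λ w → (w + j) % N) (toℕ≡dist s x) ⟨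
    (toℕ x + j) % N                           ∎

  dist-unique : ∀ x y j → j < N → toℕ y ≡ (toℕ x + j) % N → dist x y ≡ j
  dist-unique x y j j<N eq = begin
    dist x y              ≡⟨ dist-step x x y j eq ⟩
    (dist x x + j) % N    ≡⟨ cong (λ w → (w + j) % N) (dist-self x) ⟩
    j % N                 ≡⟨ m<n⇒m%n≡m j<N ⟩
    j                     ∎

  dist-shift : ∀ s j → j < N → dist s (shift s j) ≡ j
  dist-shift s j j<N = dist-unique s (shift s j) j j<N (toℕ-shift s j)

  shift-dist : ∀ s x → shift s (dist s x) ≡ x
  shift-dist s x = toℕ-injective (begin
    toℕ (shift s (dist s x))   ≡⟨ toℕ-shift s (dist s x) ⟩
    (toℕ s + dist s x) % N     ≡⟨ cong (_% N) (+-comm (toℕ s) (dist s x)) ⟩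
    (dist s x + toℕ s) % N     ≡⟨ toℕ≡dist s x ⟨
    toℕ x                      ∎)

  -- Both halves of the circle are acyclic.

  near? : ∀ s x → Dec (dist s x ≤ n)
  near? s x = dist s x ≤? n

  -- A distance of at most n plus a step of at most n stays below 2n+1, so no arc wraps around and
  -- the distance from `s` increases.
  near-acyclic : ∀ s → InducesAcyclic (C⃗ n) (λ x → dist s x ≤ n)
  near-acyclic s = acyclic-if-increasing (dist s) increasing
    where
    increasing : ∀ x y → dist s x ≤ n → dist s y ≤ n → C⃗ n x y → dist s x < dist s y
    increasing x y x≤n _ (j , 1≤j , j≤n , eq) =
      subst (dist s x <_) (sym (trans (dist-step s x y j eq) (m<n⇒m%n≡m x+j<N))) (m<m+n (dist s x) 1≤j)
      where
      x+j<N : dist s x + j < N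
      x+j<N = subst (dist s x + j <_) (sym N≡) (s≤s (+-mono-≤ x≤n j≤n))

  -- An arc that wraps past `s` lands within distance n of `s`, hence outside the far half; all
  -- other arcs increase the distance.
  far-acyclic : ∀ s → InducesAcyclic (C⃗ n) (λ x → n < dist s x)
  far-acyclic s = acyclic-if-increasing (dist s) increasing
    where
    increasing : ∀ x y → n < dist s x → n < dist s y → C⃗ n x y → dist s x < dist s y
    increasing x y _ n<y (j , 1≤j , j≤n , eq) with N ≤? dist s x + j
    ... | no N≰x+j =
      subst (dist s x <_) (sym (trans (dist-step s x y j eq) (m<n⇒m%n≡m (≰⇒> N≰x+j)))) (m<m+n (dist s x) 1≤j)
    ... | yes N≤x+j = contradiction wrapped (<⇒≱ n<y)
      where
      wrap≤n : dist s x + j ∸ N ≤ n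
      wrap≤n = ≤-trans (∸-monoˡ-≤ N (+-mono-≤ (<⇒≤ (dist<N s x)) j≤n)) (≤-reflexive (m+n∸m≡n N n))

      wrapped : dist s y ≤ n
      wrapped = subst (_≤ n)
        (sym (begin
          dist s y                  ≡⟨ dist-step s x y j eq ⟩
          (dist s x + j) % N        ≡⟨ m≤n⇒[n∸m]%m≡n%m N≤x+j ⟨
          (dist s x + j ∸ N) % N    ≡⟨ m<n⇒m%n≡m (≤-<-trans wrap≤n n<N) ⟩
          dist s x + j ∸ N          ∎))
        wrap≤n

  bisection : Fin N → Bisection (C⃗ n)
  bisection s = record
    { side    = λ x → does (near? s x)
    ; acyclic = λ where
        true  → acyclic-⊆ (λ x → does-true⇒ (near? s x)) (near-acyclic s)
        false → acyclic-⊆ (λ x → ≰⇒> ∘ does-false⇒ (near? s x)) (far-acyclic s)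
    ; outside = shift s (suc n) , dec-false (near? s (shift s (suc n)))
        (λ ≤n → <⇒≱ (n<1+n n) (subst (_≤ n) (dist-shift s (suc n) 1+n<N) ≤n))
    }
    where
    1+n<N : suc n < N
    1+n<N = subst (suc n <_) (sym N≡) (m<m+n (suc n) 1≤n)

  -- Acyclic sets lie in half-circles.

  triangle⇒¬acyclic : ∀ {S : Fin N → Set} {x y z} → C⃗ n x y → C⃗ n y z → C⃗ n z x →
    x ≢ y → x ≢ z → y ≢ z → S x → S y → S z → ¬ InducesAcyclic (C⃗ n) S
  triangle⇒¬acyclic x→y y→z z→x x≢y x≢z y≢z Sx Sy Sz acyclic = acyclic
    ( mkCycle _ _ _ ((x≢y ∷ x≢z ∷ []) ∷ (y≢z ∷ []) ∷ [] ∷ []) (step x→y (step y→z done)) z→x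
    , Sx , Sy ∷ Sz ∷ [] )

  -- Of the vertices of S in the far half seen from s ∈ S, let a be the nearest.  A vertex y of S
  -- outside the half-circle from a would close a directed triangle s → y → a → s.
  enclosed-from : ∀ {S : Fin N → Set} → InducesAcyclic (C⃗ n) S →
    ∀ {s a} → S s → S a → n < dist s a → (∀ y → S y → n < dist s y → dist s a ≤ dist s y) →
    ∀ y → S y → dist a y ≤ n
  enclosed-from {S} acyclic {s} {a} Ss Sa n<p minimal y Sy with near? s y | near? a y
  ... | _ | yes a≤n = a≤n
  -- Both vertices are far from `s` and `a` is the nearer, so the way from `a` to `y` does not pass
  -- `s` and has length at most 2n - n.
  ... | no y≰n | no a≰n = contradiction (subst (_≤ n) (sym a≡) q∸p≤n) a≰n
    where
    p = dist s a
    q = dist s y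
    p≤q : p ≤ q
    p≤q = minimal y Sy (≰⇒> y≰n)

    q∸p≤n : q ∸ p ≤ n
    q∸p≤n = ≤-trans (∸-mono (dist≤2n s y) (<⇒≤ n<p))
      (≤-reflexive (trans (m+n∸m≡n n (n + 0)) (+-identityʳ n)))

    a≡ : dist a y ≡ q ∸ p
    a≡ = dist-unique a y (q ∸ p) (≤-<-trans q∸p≤n n<N)
      (dist-step⁻¹ s a y (q ∸ p) (trans (cong (_% N) (m+[n∸m]≡n p≤q)) (m<n⇒m%n≡m (dist<N s y))))
  ... | yes q≤n | no a≰n = contradiction acyclic
    (triangle⇒¬acyclic s→y y→a a→s
      (λ { refl → n≮0 (subst (0 <_) (dist-self s) 0<q) })
      (λ { refl → n≮0 (subst (n <_) (dist-self s) n<p) })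
      (λ { refl → <-irrefl refl (≤-<-trans q≤n n<p) })
      Ss Sy Sa)
    where
    p = dist s a
    q = dist s y

    q<p : q < p
    q<p = ≤-<-trans q≤n n<p

    -- The length of the way from `a` on to `s`; the way from `a` to `y` passes `s`, so its length
    -- is r + q.
    r = N ∸ p
    p+r≡N : p + r ≡ N
    p+r≡N = m+[n∸m]≡n (<⇒≤ (dist<N s a))

    a≡ : dist a y ≡ q + r
    a≡ = dist-unique a y (q + r) (subst (q + r <_) p+r≡N (+-monoˡ-< r q<p))
      (dist-step⁻¹ s a y (q + r) (begin
        (p + (q + r)) % N    ≡⟨ cong (_% N) (x∙yz≈y∙xz p q r) ⟩
        (q + (p + r)) % N    ≡⟨ cong (λ w → (q + w) % N) p+r≡N ⟩
        (q + N) % N          ≡⟨ [m+n]%n≡m%n q N ⟩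
        q % N                ≡⟨ m<n⇒m%n≡m (dist<N s y) ⟩
        q                    ∎))

    -- This one inequality yields two arc conditions: q > 0 because r ≤ n, and p - q ≤ n because (p
    -- - q) + (q + r) = 2n+1.
    n<q+r : n < q + r
    n<q+r = subst (n <_) a≡ (≰⇒> a≰n)

    r≤n : r ≤ n
    r≤n = ≤-trans (∸-monoʳ-≤ N n<p) (≤-reflexive (trans (cong (_∸ suc n) N≡) (m+n∸m≡n (suc n) n)))

    0<q : 0 < q
    0<q = +-cancelʳ-< r 0 q (≤-<-trans r≤n n<q+r)

    p∸q≤n : p ∸ q ≤ n
    p∸q≤n = m≤n+o⇒m∸n≤o p q (+-cancelʳ-≤ r p (q + n)
      (subst₂ _≤_ (sym (trans p+r≡N N≡)) (xy∙z≈xz∙y q r n) (+-monoˡ-≤ n n<q+r)))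

    s→y : C⃗ n s y
    s→y = q , 0<q , q≤n , dist-step⁻¹ s s y q
      (trans (cong (λ w → (w + q) % N) (dist-self s)) (m<n⇒m%n≡m (dist<N s y)))

    y→a : C⃗ n y a
    y→a = p ∸ q , m<n⇒0<n∸m q<p , p∸q≤n , dist-step⁻¹ s y a (p ∸ q)
      (trans (cong (_% N) (m+[n∸m]≡n (<⇒≤ q<p))) (m<n⇒m%n≡m (dist<N s a)))

    a→s : C⃗ n a s
    a→s = r , m<n⇒0<n∸m (dist<N s a) , r≤n , dist-step⁻¹ s a s r
      (trans (cong (_% N) p+r≡N) (trans (n%n≡0 N) (sym (dist-self s))))

  -- Starting from any `s` in `S`, either no vertex of `S` is far from `s` and the half-circle at
  -- `s` works, or the one at the nearest far vertex does.
  enclosed : ∀ {S : Fin N → Set} → Decidable S → InducesAcyclic (C⃗ n) S →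
             ∃[ s ] (∀ x → S x → dist s x ≤ n)
  enclosed {S} S? acyclic with any? S?
  ... | no empty = zero , λ x Sx → contradiction (x , Sx) empty
  ... | yes (s , Ss) = search (all? Q?)
    where
    Q : Fin N → Set
    -- Negated so that the smallest `d` violating `Q` is the distance of the nearest far vertex of
    -- `S`.
    Q d = ¬ (n < toℕ d × S (shift s (toℕ d)))

    Q? : Decidable Q
    Q? d = ¬? ((suc n ≤? toℕ d) ×-dec S? (shift s (toℕ d)))

    far : ∀ y → S y → n < dist s y → (d : Fin N) → toℕ d ≡ dist s y → ¬ Q d
    far y Sy n<q d d≡ Qd = Qd (subst (n <_) (sym d≡) n<q ,
      subst S (sym (trans (cong (shift s) d≡) (shift-dist s y))) Sy)

    search : Dec (∀ d → Q d) → ∃[ s ] (∀ x → S x → dist s x ≤ n)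
    search (yes all-near) = s , λ x Sx → ≮⇒≥ λ n<x →
      far x Sx n<x (fromℕ< (dist<N s x)) (toℕ-fromℕ< (dist<N s x)) (all-near _)
    search (no ¬all) with ¬∀⟶∃¬-smallest N Q Q? ¬all
    ... | d , ¬Qd , below with (suc n ≤? toℕ d) ×-dec S? (shift s (toℕ d))
    ... | no ¬far = contradiction ¬far ¬Qd
    ... | yes (n<d , Sa) = shift s (toℕ d) ,
      enclosed-from acyclic Ss Sa (subst (n <_) (sym p≡d) n<d)
        λ y Sy n<q → subst (_≤ dist s y) (sym p≡d) (≮⇒≥ λ q<d →
          far y Sy n<q (inject (fromℕ< q<d)) (trans (toℕ-inject (fromℕ< q<d)) (toℕ-fromℕ< q<d)) (below (fromℕ< q<d)))
      where
      p≡d = dist-shift s (toℕ d) (toℕ<n d)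

  bisect : ∀ {k} α → IsColoring k (C⃗ n) α → ∀ c →
           Σ (Bisection (C⃗ n)) λ B → ∀ x → lookup α x ≡ c → Bisection.side B x ≡ true
  bisect α vα c with enclosed (λ x → lookup α x ≟ c) (vα c)
  ... | s , near = bisection s , λ x αx≡c → dec-true (near? s x) (near x αx≡c)

-- The diameter bound.

theorem2 : (n k : ℕ) → 2 ≤ n → 3 ≤ k →
    Mixing k (C⃗ n) × DiameterAtMost k (C⃗ n) (4 * n + 1 + (n + 1) / 2)
theorem2 n (suc (suc (suc k))) 2≤n (s≤s (s≤s (s≤s _))) =
  (λ α β → map₂ proj₂ (diameter α β)) ,
  (λ α β → map₂ (λ { (l≤ , w) → ≤-trans l≤ bound , w }) (diameter α β))
  where
  open CyclicTournament n (≤-trans (n≤1+n 1) 2≤n) using (bisect)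
  open Bisectable {k = k} (C⃗ n) bisect using (diameter)

  -- The length 4n+2 exceeds 4n+1 by 1 = 2/2, which is at most (n+1)/2 since n+1 ≥ 2.
  bound : suc (2 * n) * 2 ≤ 4 * n + 1 + (n + 1) / 2
  bound = ≤-trans (≤-reflexive (expand n))
    (+-monoʳ-≤ (4 * n + 1) (/-monoˡ-≤ 2 (≤-trans 2≤n (m≤m+n n 1))))
    where
    expand : ∀ n → suc (2 * n) * 2 ≡ 4 * n + 1 + 1
    expand = solve-∀
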